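{- For any family of Boolean functions $F = \{f_n\}_{n \in \mathbb{N}}$ and any $\Delta\colon \mathbb{N} \to \mathbb{N}$, $\mathcal{L}^{\mathrm{LNBP}_{\Delta(n)}}_F(n) \in O\bigl(\Gamma(n, \Delta(n))\bigr)$. In particular, $\mathcal{L}^{\mathrm{BP}}_F(n) \in O\bigl(\frac{n^2}{\log^2_2 n}\bigr)$.
   Context: For an $n$-ary Boolean function $f$ and $V \subseteq [n]$, $r_V(f)$ denotes the number of distinct subfunctions of $f$ on $V$ obtained by fixing the variables outside $V$. A Nečiporuk function for a complexity measure $\mathbf{M}$ is a non-decreasing $b\colon \mathbb{N}_{>0}\to\mathbb{N}$ such that for every $n$, every $n$-ary $f$ and every partition $V_1,\dots,V_p$ of $[n]$, $\mathbf{M}(f) \ge \sum_{i=1}^p b(r_{V_i}(f))$; $\mathcal{N}_{\mathbf{M}}$ is the set of these, and $\mathcal{L}^{\mathbf{M}}_F(n) = \max\{\sum_{i=1}^p b(r_{V_i}(f_n)) \mid b \in \mathcal{N}_{\mathbf{M}},\ V_1,\dots,V_p \text{ partition of } [n]\}$. $\mathrm{BP}(f)$ is the minimum number of non-sink vertices of a deterministic branching program computing $f$. A $\delta$-limited nondeterministic branching program for $f\colon\{0,1\}^n\to\{0,1\}$ is a deterministic branching program computing some $f'$ on $n+\delta$ variables with $f(a) = \bigvee_{b \in \{0,1\}^\delta} f'(a,b)$; $\mathrm{LNBP}_\delta(f)$ is the minimum number of non-sink vertices of such a program. $\Gamma\colon[2,+\infty)\times\mathbb{N}_{>0}\to\mathbb{R}$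 is defined by $\Gamma(x,\delta) = \max\bigl\{\frac{x^2}{2^\delta(\log_2 x - \delta)\log_2 x}, x\bigr\}$ if $2^{\delta+1} \le x$, and $\Gamma(x,\delta) = x$ otherwise. -}

module Defs where

open import Data.Nat using (ℕ; zero; suc; _+_; _*_; _∸_; _^_; _≤_; _<_)
open import Data.Bool using (Bool; true; false; if_then_else_)
import Data.Bool as Bool
open import Data.Fin using (Fin; zero; suc)
open import Data.Vec using (Vec; []; _∷_; lookup; tabulate; _++_)
open import Data.List using (List; []; _∷_; [_]; map; concatMap; length; deduplicate; allFin)
open import Data.Nat.ListAction using (sum)
open import Data.Bool.ListAction using (any)
open import Data.List.Properties using (≡-dec)
open import Data.Product using (Σ; ∃; _×_; _,_)
open import Data.Sum using (_⊎_; inj₁; inj₂)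
open import Relation.Binary.PropositionalEquality using (_≡_)
import Data.Fin as Fin
open import Relation.Nullary.Decidable.Core using (isYes)

BoolFn : ℕ → Set
BoolFn n = Vec Bool n → Bool

allVecs : (n : ℕ) → List (Vec Bool n)
allVecs zero    = [ [] ]
allVecs (suc n) = concatMap (λ v → (false ∷ v) ∷ (true ∷ v) ∷ []) (allVecs n)

merge : ∀ {n} → (Fin n → Bool) → Vec Bool n → Vec Bool n → Vec Bool n
merge V ρ z = tabulate (λ j → if V j then lookup z j else lookup ρ j)

-- The subfunction of f on V obtained by fixing the variables outside V
-- as in ρ, represented by its full truth table (as z ranges over all
-- assignments; only z restricted to V matters).
subfunctionTable : ∀ {n} → (Fin n → Bool) → BoolFn n → Vec Bool n → List Bool
subfunctionTable {n} V f ρ = map (λ z → f (merge V ρ z)) (allVecs n)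

r : ∀ {n} → (Fin n → Bool) → BoolFn n → ℕ
r {n} V f = length (deduplicate (≡-dec Bool._≟_) (map (subfunctionTable V f) (allVecs n)))

IsPartition : ∀ {n p} → (Fin n → Fin p) → Set
IsPartition {n} {p} c = ∀ (i : Fin p) → ∃ λ (j : Fin n) → c j ≡ i

block : ∀ {n p} → (Fin n → Fin p) → Fin p → (Fin n → Bool)
block c i j = isYes (c j Fin.≟ i)

necSum : ∀ {n p} → (ℕ → ℕ) → BoolFn n → (Fin n → Fin p) → ℕ
necSum {p = p} b f c = sum (map (λ i → b (r (block c i) f)) (allFin p))

-- Deterministic branching programs, topologically sorted.
-- Prog m k : a program over m variables with k non-sink vertices.
-- A target is either a sink (inj₁ b, the sink labelled b) or a
-- non-sink vertex.  Each newly added vertex is labelled by a variable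
-- and has a 0-successor and a 1-successor among the previously added
-- vertices or the sinks; hence the graph is acyclic, and every DAG
-- branching program can be listed this way.

Target : ℕ → Set
Target k = Bool ⊎ Fin k

data Prog (m : ℕ) : ℕ → Set where
  []  : Prog m 0
  node : ∀ {k} → Fin m → Target k → Target k → Prog m k → Prog m (suc k)

eval : ∀ {m k} → Prog m k → Vec Bool m → Target k → Bool
eval P x (inj₁ b) = b
eval (node v t₀ t₁ P) x (inj₂ zero) = eval P x (if lookup x v then t₁ else t₀)
eval (node v t₀ t₁ P) x (inj₂ (suc j)) = eval P x (inj₂ j)

-- A complexity measure M is described by "M-programs of size k for f exist".
Measure : Set₁
Measure = (n : ℕ) → BoolFn n → ℕ → Set

BPRealizes : Measure
BPRealizes n f k = Σ (Prog n k) λ P → Σ (Target k) λ s → ∀ x → eval P x s ≡ f x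

LNBPRealizes : ℕ → Measure
LNBPRealizes δ n f k =
  Σ (Prog (n + δ) k) λ P → Σ (Target k) λ s →
    ∀ a → f a ≡ any (λ b → eval P (a ++ b) s) (allVecs δ)

-- M(f) ≥ s, where M(f) is the minimum size of a realizing program.
_≥M_ : ∀ {n} → (Measure × BoolFn n) → ℕ → Set
_≥M_ {n} (M , f) s = ∀ k → M n f k → s ≤ k

-- Nečiporuk functions for M (values of b at 0 are irrelevant since
-- r_V(f) ≥ 1; monotonicity is required on ℕ_{>0}).
IsNeciporuk : Measure → (ℕ → ℕ) → Set
IsNeciporuk M b =
  (∀ x y → 1 ≤ x → x ≤ y → b x ≤ b y) ×
  (∀ n (f : BoolFn n) p (c : Fin n → Fin p) → IsPartition c →
     (M , f) ≥M necSum b f c)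

-- "L ≤ C · Γ(x, δ)" expressed exactly in ℕ.
-- For 2^{δ+1} ≤ x, t = log₂ x ≥ δ + 1 and
--   L ≤ C·Γ ⇔ L ≤ C·x  ∨  L·2^δ·(t-δ)·t ≤ C·x²,
-- and the latter (t ↦ (t-δ)t being continuous and increasing on [δ,∞))
-- holds iff it holds for every rational q = a/b ∈ [δ, t), i.e. for every
-- a, b with b ≥ 1, δb ≤ a and 2^a < x^b:  L·2^δ·(a-δb)·a ≤ C·x²·b².
LeqCΓ : ℕ → ℕ → ℕ → ℕ → Set
LeqCΓ C L x δ =
  (2 ^ (δ + 1) ≤ x →
     (L ≤ C * x) ⊎
     (∀ a b → 1 ≤ b → δ * b ≤ a → 2 ^ a < x ^ b →
        L * 2 ^ δ * (a ∸ δ * b) * a ≤ C * x ^ 2 * b ^ 2)) ×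
  (x < 2 ^ (δ + 1) → L ≤ C * x)

-- "L ≤ C · x² / log₂² x" for x ≥ 2, exactly: for every rational
-- q = a/b ∈ [0, log₂ x) (i.e. b ≥ 1, 2^a < x^b): L·a² ≤ C·x²·b².
LeqCSqOverLog² : ℕ → ℕ → ℕ → Set
LeqCSqOverLog² C L x = ∀ a b → 1 ≤ b → 2 ^ a < x ^ b → L * a ^ 2 ≤ C * x ^ 2 * b ^ 2

{-# OPTIONS --safe #-}
module Submission where

-- A cheap function with R subfunctions on each of many blocks bounds b(R) for every Nečiporuk function b.
-- Such a function is indirect storage access: an address selects one of p blocks of v bits, and the selected
-- block is an index into a store of 2^v bits, so every block has 2^2^v subfunctions.  A program guesses the
-- first δ bits of the selected block (checking the guess costs 3δ vertices per block), reads u of the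
-- remaining w = v − δ bits, loads the 2^s store bits that the last s = w − u bits can address, and only then
-- branches on those s bits.  Everything that touches the store is shared by all blocks, so for p → ∞ the cost
-- per block is 3δ + O(2^u + 2^2^s · 2^s), which is O(δ + 2^w / w) when 2^s is about w/2; this bounds b(2^2^v).
-- An arbitrary f on n < 2^t variables has r_V(f) ≤ 2^2^min(|V|, t), and the bounds are summed over the blocks.

open import Defs
open import Data.Bool using (Bool; true; false; if_then_else_; _∧_; _∨_)
import Data.Bool as Bool
open import Data.Bool.ListAction using (any)
open import Data.Bool.Properties using (∧-zeroʳ; ∨-zeroʳ; ∨-identityʳ)
open import Data.Fin using (Fin; zero; suc; combine; remQuot; splitAt; fromℕ<; _↑ˡ_; _↑ʳ_)
import Data.Fin as Fin
open import Data.Fin.Properties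
  using (2↔Bool; remQuot-combine; combine-remQuot; splitAt-↑ˡ; splitAt-↑ʳ; suc-injective; injective⇒≤)
open import Data.List as List using (List; []; _∷_; length; map; concatMap; allFin; deduplicate)
open import Data.List.Membership.Propositional using (_∈_)
open import Data.List.Membership.Propositional.Properties
  using (∈-allFin; ∈-concatMap⁺; ∈-map⁺; ∈-map⁻; ∈-lookup; ∈-length; ∈-deduplicate⁺; ∈-deduplicate⁻)
import Data.List.Membership.Setoid.Properties as Membership
open import Data.List.Properties
  using (≡-dec; ∷-injective; length-map; length-tabulate; length-deduplicate; map-cong; map-tabulate)
open import Data.List.Relation.Unary.All as All using ([]; _∷_)
open import Data.List.Relation.Unary.AllPairs using ([]; _∷_)
open import Data.List.Relation.Unary.Any as Any using (here; there)
open import Data.List.Relation.Unary.Unique.DecPropositional.Properties (≡-dec Bool._≟_) using (deduplicate-!)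
open import Data.List.Relation.Unary.Unique.Propositional using (Unique)
open import Data.Nat
  using (ℕ; zero; suc; _+_; _*_; _∸_; _^_; _⊓_; _≤_; _<_; z≤n; s≤s; s≤s⁻¹; >-nonZero; _≤?_; _<?_)
open import Data.Nat.ListAction using (sum)
open import Data.Nat.Properties hiding (suc-injective)
open import Data.Nat.Tactic.RingSolver using (solve-∀)
open import Data.Product using (∃; _×_; _,_; proj₁; proj₂; uncurry)
open import Data.Sum using (inj₁; inj₂; [_,_]′)
open import Data.Unit using (⊤; tt)
open import Data.Vec as Vec using (Vec; []; _∷_; lookup; tabulate; _++_)
open import Data.Vec.Properties
  using (lookup∘tabulate; tabulate∘lookup; tabulate-cong; tabulate-∘; lookup-++ˡ; lookup-++ʳ;
         lookup-map; lookup-splitAt)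
open import Function using (_∘_; Inverse; id)
open import Relation.Binary.PropositionalEquality
open import Relation.Nullary using (does; yes; no; contradiction)
open import Relation.Nullary.Decidable using (isYes≗does; dec-true)

open ≤-Reasoning

-- Assignments and their numbering

∈-allVecs : ∀ {n} (v : Vec Bool n) → v ∈ allVecs n
∈-allVecs []      = here refl
∈-allVecs (b ∷ v) = ∈-concatMap⁺ _ (Any.map (λ { refl → pick b }) (∈-allVecs v))
  where
  pick : ∀ b → (b ∷ v) ∈ ((false ∷ v) ∷ (true ∷ v) ∷ [])
  pick false = here refl
  pick true  = there (here refl)

length-allVecs : ∀ n → length (allVecs n) ≡ 2 ^ n
length-allVecs zero    = refl
length-allVecs (suc n) = trans (doubled (allVecs n)) (cong (2 *_) (length-allVecs n))
  where
  doubled : ∀ vs → length (concatMap (λ v → (false ∷ v) ∷ (true ∷ v) ∷ []) vs) ≡ 2 * length vs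
  doubled []       = refl
  doubled (_ ∷ vs) = trans (cong (2 +_) (doubled vs)) (sym (*-suc 2 (length vs)))

encode : ∀ {n} → Vec Bool n → Fin (2 ^ n)
encode []      = zero
encode (b ∷ v) = combine (Inverse.from 2↔Bool b) (encode v)

decode : ∀ {n} → Fin (2 ^ n) → Vec Bool n
decode {zero}  _ = []
decode {suc n} k = let (b , l) = remQuot (2 ^ n) k in Inverse.to 2↔Bool b ∷ decode l

decode-encode : ∀ {n} (v : Vec Bool n) → decode (encode v) ≡ v
decode-encode []      = refl
decode-encode (b ∷ v) = cong₂ _∷_
  (trans (cong (Inverse.to 2↔Bool ∘ proj₁) eq) (Inverse.strictlyInverseˡ 2↔Bool b))
  (trans (cong (decode ∘ proj₂) eq) (decode-encode v))
  where eq = remQuot-combine (Inverse.from 2↔Bool b) (encode v)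

encode-decode : ∀ {n} (k : Fin (2 ^ n)) → encode {n} (decode k) ≡ k
encode-decode {zero}  zero = refl
encode-decode {suc n} k    = trans
  (cong₂ combine (Inverse.strictlyInverseʳ 2↔Bool (proj₁ (remQuot {2} (2 ^ n) k))) (encode-decode {n} _))
  (combine-remQuot {2} (2 ^ n) k)

-- Building branching programs incrementally

Realized : ∀ {m k} → Prog m k → BoolFn m → Set
Realized {k = k} P g = ∃ λ (s : Target k) → ∀ x → eval P x s ≡ g x

const-realized : ∀ {m k} (P : Prog m k) b → Realized P (λ _ → b)
const-realized P b = inj₁ b , λ _ → refl

-- Tracks the functions computed at the vertices rather than the vertices, which are renumbered by every addition.
record Extension {m k} {J : Set} (P : Prog m k) (c : ℕ) (T : J → BoolFn m) : Set where
  constructor extension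
  field
    {size}   : ℕ
    size≤    : size ≤ c + k
    prog     : Prog m size
    keeps    : ∀ {g} → Realized P g → Realized prog g
    provides : ∀ j → Realized prog (T j)

open Extension

module _ {m k} {P : Prog m k} where

  nothing-added : ∀ {J : Set} {T : J → BoolFn m} → (∀ j → Realized P (T j)) → Extension P 0 T
  nothing-added T∈P = extension ≤-refl P (λ r → r) T∈P

  -- Realization speaks of values only, so pointwise equality lets one family replace another
  -- without function extensionality.
  reindex : ∀ {c} {I J : Set} {T : I → BoolFn m} {U : J → BoolFn m} →
            (∀ j → ∃ λ i → ∀ x → T i x ≡ U j x) → Extension P c T → Extension P c U
  reindex ι E = extension (size≤ E) (prog E) (keeps E) λ j →
    let (s , e) = provides E (proj₁ (ι j)) in s , λ x → trans (e x) (proj₂ (ι j) x)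

  infixl 1 _>>_
  _>>_ : ∀ {c d} {I J : Set} {T : I → BoolFn m} {U : J → BoolFn m} →
         (E : Extension P c T) → Extension (prog E) d U → Extension P (d + c) U
  _>>_ {c} {d} E F = extension
    (≤-trans (size≤ F) (≤-trans (+-monoʳ-≤ d (size≤ E)) (≤-reflexive (sym (+-assoc d c k)))))
    (prog F) (keeps F ∘ keeps E) (provides F)

  relax : ∀ {c d} {J : Set} {T : J → BoolFn m} → c ≤ d → Extension P c T → Extension P d T
  relax c≤d E = extension (≤-trans (size≤ E) (+-monoˡ-≤ k c≤d)) (prog E) (keeps E) (provides E)

  branch : ∀ v {g h} → Realized P g → Realized P h →
           Extension P 1 (λ (_ : ⊤) x → if lookup x v then h x else g x)
  branch v {g} {h} (s₀ , e₀) (s₁ , e₁) = extension ≤-refl (node v s₀ s₁ P) lift λ _ → inj₂ zero , top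
    where
    lift : ∀ {g} → Realized P g → Realized (node v s₀ s₁ P) g
    lift (inj₁ b , e) = inj₁ b , e
    lift (inj₂ j , e) = inj₂ (suc j) , e
    top : ∀ x → eval (node v s₀ s₁ P) x (inj₂ zero) ≡ (if lookup x v then h x else g x)
    top x with lookup x v
    ... | true  = e₁ x
    ... | false = e₀ x

infix 4 _≼_
_≼_ : ∀ {m k k′} → Prog m k → Prog m k′ → Set
P ≼ Q = ∀ {g} → Realized P g → Realized Q g

module _ {m} {I J : Set} {T : I → J → BoolFn m} {c : ℕ} where

  -- The construction for one item runs on whatever program the earlier items left behind, so
  -- `build` accepts every `Q` that still realizes the functions of `P`. Membership proofs as
  -- indices allow recursion on the list; `forEach` removes them.
  forEach∈ : ∀ {k} {P : Prog m k} (is : List I) →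
             (∀ i {k′} (Q : Prog m k′) → P ≼ Q → Extension Q c (T i)) →
             Extension P (length is * c) (λ (((i , _) , j) : (∃ λ i → i ∈ is) × J) → T i j)
  forEach∈ {P = P} [] build = nothing-added λ { ((_ , ()) , _) }
  forEach∈ {P = P} (i ∷ is) build =
    let first = build i P (λ r → r)
        rest  = forEach∈ is λ i′ Q P≼Q → build i′ Q (P≼Q ∘ keeps first)
    in relax (≤-reflexive (+-comm (length is * c) c))
      (extension (size≤ (first >> rest)) (prog rest) (keeps rest ∘ keeps first)
         λ { ((_ , here refl) , j) → keeps rest (provides first j)
           ; ((i′ , there i′∈) , j) → provides rest ((i′ , i′∈) , j) })

  forEach : ∀ {k} {P : Prog m k} (is : List I) → (∀ i → i ∈ is) →
            (∀ i {k′} (Q : Prog m k′) → P ≼ Q → Extension Q c (T i)) →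
            Extension P (length is * c) (uncurry T)
  forEach is complete build = reindex (λ (i , j) → ((i , complete i) , j) , λ _ → refl) (forEach∈ is build)

-- Decision trees, selection and comparison

treeSize : ℕ → ℕ
treeSize zero    = 0
treeSize (suc q) = suc (treeSize q + treeSize q)

module _ {m : ℕ} where

  read : ∀ {q} → Vec (Fin m) q → Vec Bool m → Vec Bool q
  read vs x = Vec.map (lookup x) vs

  -- The leaves are functions already realized and may depend on `x` again, so trees can be stacked
  -- on shared vertices.
  tree : ∀ {q k} {P : Prog m k} (vs : Vec (Fin m) q) {h : Vec Bool q → BoolFn m} →
         (∀ z → Realized P (h z)) → Extension P (treeSize q) (λ (_ : ⊤) x → h (read vs x) x)
  tree []       h∈P = nothing-added λ _ → h∈P []
  tree {P = P} (v ∷ vs) {h} h∈P =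
    let low  = tree vs (λ z → h∈P (false ∷ z))
        high = tree vs (λ z → keeps low (h∈P (true ∷ z)))
        both = low >> high
    in reindex (λ _ → tt , join) (both >> branch v (keeps high (provides low tt)) (provides high tt))
    where
    join : ∀ x → (if lookup x v then h (true ∷ read vs x) x else h (false ∷ read vs x) x)
                 ≡ h (lookup x v ∷ read vs x) x
    join x with lookup x v
    ... | true  = refl
    ... | false = refl

-- A priority choice with a value for every address, so that one vertex per index evaluates it;
-- `isa-subfunctions` uses addresses with a single bit set.
select : ∀ p → (Fin p → Bool) → (Fin p → Bool) → Bool
select zero    a d = false
select (suc p) a d = if a zero then d zero else select p (a ∘ suc) (d ∘ suc)

matches : ∀ {e} → Vec Bool e → Vec Bool e → Bool
matches []       []       = true
matches (a ∷ as) (b ∷ bs) =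
  if a then (if b then matches as bs else false) else (if b then false else matches as bs)

selection : ∀ {m p k} {P : Prog m k} (a : Fin p → Fin m) {d : Fin p → BoolFn m} →
            (∀ i → Realized P (d i)) →
            Extension P p (λ (_ : ⊤) x → select p (λ i → lookup x (a i)) (λ i → d i x))
selection {p = zero}  {P = P} a d∈P = nothing-added λ _ → const-realized P false
selection {p = suc p} a d∈P =
  let rest = selection (a ∘ suc) (d∈P ∘ suc)
  in rest >> branch (a zero) (provides rest tt) (keeps rest (d∈P zero))

-- Each position costs three vertices: one for the bit of `as`, and one for the bit of `bs` under
-- each value of the former.
comparison : ∀ {m e k} {P : Prog m k} (as bs : Vec (Fin m) e) {h : BoolFn m} → Realized P h →
             Extension P (e * 3) (λ (_ : ⊤) x → matches (read as x) (read bs x) ∧ h x)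
comparison []       []       h∈P = nothing-added λ _ → h∈P
comparison {m} (a ∷ as) (b ∷ bs) {h} h∈P =
  let rest = comparison as bs h∈P
      off  = const-realized (prog rest) false
      neg  = branch b (provides rest tt) off
      pos  = branch b (keeps neg off) (keeps neg (provides rest tt))
      top  = branch a (keeps pos (provides neg tt)) (provides pos tt)
  in reindex (λ _ → tt , join) (rest >> neg >> pos >> top)
  where
  join : ∀ x → let M = matches (read as x) (read bs x) ∧ h x in
         (if lookup x a then (if lookup x b then M else false) else (if lookup x b then false else M))
         ≡ matches (read (a ∷ as) x) (read (b ∷ bs) x) ∧ h x
  join x with lookup x a | lookup x b
  ... | true  | true  = refl
  ... | true  | false = refl
  ... | false | true  = refl
  ... | false | false = refl

1+treeSize : ∀ q → suc (treeSize q) ≡ 2 ^ q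
1+treeSize zero    = refl
1+treeSize (suc q) = begin-equality
  suc (suc (treeSize q + treeSize q))  ≡⟨ lemma (treeSize q) ⟩
  2 * suc (treeSize q)                 ≡⟨ cong (2 *_) (1+treeSize q) ⟩
  2 ^ suc q                            ∎
  where
  lemma : ∀ t → suc (suc (t + t)) ≡ 2 * suc t
  lemma = solve-∀

treeSize≤2^ : ∀ q → treeSize q ≤ 2 ^ q
treeSize≤2^ q = ≤-trans (n≤1+n _) (≤-reflexive (1+treeSize q))

select-cong : ∀ p {a a′ d d′ : Fin p → Bool} → (∀ i → a i ≡ a′ i) → (∀ i → d i ≡ d′ i) →
              select p a d ≡ select p a′ d′
select-cong zero    a≗a′ d≗d′ = refl
select-cong (suc p) {a} {a′} a≗a′ d≗d′ with a zero | a′ zero | a≗a′ zero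
... | true  | _ | refl = d≗d′ zero
... | false | _ | refl = select-cong p (a≗a′ ∘ suc) (d≗d′ ∘ suc)

-- Both selections follow the same address and stop at the same index. Hence a program may forget
-- the selected block and find it again later.
select-diagonal : ∀ p a (c : Fin p → Bool) (d : Fin p → Fin p → Bool) →
                  select p a (λ i → c i ∧ select p a (d i)) ≡ select p a (λ i → c i ∧ d i i)
select-diagonal zero    a c d = refl
select-diagonal (suc p) a c d with a zero
... | true  = refl
... | false = select-diagonal p (a ∘ suc) (c ∘ suc) (λ i → d (suc i) ∘ suc)

-- Indirect storage access

-- `ownSize` is charged per block: under each of the 2^2^s tables a tree on s bits and a selection
-- vertex, then the tree on u middle bits, the comparison of e bits, and a vertex of the first
-- selection. `sharedSize` pays for reading the guess and the store.
ownSize sharedSize : ℕ → ℕ → ℕ → ℕ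
ownSize e u s    = 2 ^ 2 ^ s * suc (2 ^ s) + 2 ^ u + e * 3 + 1
sharedSize e u s = 2 ^ u * (2 ^ e + 2 ^ e * 2 ^ 2 ^ (e + (u + s)))

module _ {m} (p e u s : ℕ) (address : Fin p → Fin m)
         (high : Fin p → Vec (Fin m) e) (middle : Fin p → Vec (Fin m) u) (low : Fin p → Vec (Fin m) s)
         (guess : Vec (Fin m) e) (store : Vec (Fin m) (2 ^ (e + (u + s)))) where

  private
    v = e + (u + s)

    addressed : (Fin p → Bool) → Vec Bool m → Bool
    addressed d x = select p (λ i → lookup x (address i)) d

    -- The part of the store still within reach once the first e + u bits of the index are known.
    row : Vec Bool e → Vec Bool u → Vec Bool (2 ^ v) → Vec Bool (2 ^ s)
    row g y D = tabulate λ k → lookup D (encode (g ++ (y ++ decode k)))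

    -- The block is selected anew here: its number is forgotten while the store is read, so that all
    -- blocks share the vertices reading the store.
    byTable : Vec Bool (2 ^ s) → BoolFn m
    byTable t x = addressed (λ i → lookup t (encode (read (low i) x))) x

    byRow : Vec Bool u → BoolFn m
    byRow y x = byTable (row (read guess x) y (read store x)) x

    guessing : Fin p → BoolFn m
    guessing i x = matches (read (high i) x) (read guess x) ∧ byRow (read (middle i) x) x

    tables : ∀ {k} (P : Prog m k) →
             Extension P (2 ^ 2 ^ s * (p + p * 2 ^ s)) (λ ((t , _) : Vec Bool (2 ^ s) × ⊤) → byTable t)
    tables P = relax (≤-reflexive (cong (_* (p + p * 2 ^ s)) (length-allVecs (2 ^ s))))
      (forEach (allVecs (2 ^ s)) ∈-allVecs λ t Q _ →
        let leaves = relax (≤-reflexive (cong (_* 2 ^ s) (length-tabulate {n = p} id)))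
              (forEach (allFin p) ∈-allFin λ i R _ →
                relax (treeSize≤2^ s) (tree (low i) {λ z _ → lookup t (encode z)} λ z → const-realized R _))
        in leaves >> selection address λ i → provides leaves (i , tt))

    rows : ∀ {k} (P : Prog m k) → (∀ t → Realized P (byTable t)) →
           Extension P (sharedSize e u s) (λ ((y , _) : Vec Bool u × ⊤) → byRow y)
    rows P table∈P = relax (≤-reflexive (cong (_* (2 ^ e + 2 ^ e * 2 ^ 2 ^ v)) (length-allVecs u)))
      (forEach (allVecs u) ∈-allVecs λ y Q P≼Q →
        let guessed = relax (≤-reflexive (cong (_* 2 ^ 2 ^ v) (length-allVecs e)))
              (forEach (allVecs e) ∈-allVecs λ g R Q≼R →
                relax (treeSize≤2^ (2 ^ v)) (tree store {λ D → byTable (row g y D)} λ D →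
                   Q≼R (P≼Q (table∈P (row g y D)))))
        in guessed >> relax (treeSize≤2^ e) (tree guess λ g → provides guessed (g , tt)))

    guesses : ∀ {k} (P : Prog m k) → (∀ y → Realized P (byRow y)) →
              Extension P (p * (e * 3 + 2 ^ u)) (λ ((i , _) : Fin p × ⊤) → guessing i)
    guesses P row∈P = relax (≤-reflexive (cong (_* (e * 3 + 2 ^ u)) (length-tabulate {n = p} id)))
      (forEach (allFin p) ∈-allFin λ i Q P≼Q →
        let walk = tree (middle i) λ y → P≼Q (row∈P y)
        in relax (treeSize≤2^ u) walk >> comparison (high i) guess (provides walk tt))

  storageAccess : Extension {m} [] (p * ownSize e u s + sharedSize e u s) λ (_ : ⊤) x →
    addressed (λ i → matches (read (high i) x) (read guess x)
                     ∧ lookup (read store x) (encode (read guess x ++ (read (middle i) x ++ read (low i) x)))) x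
  storageAccess =
    -- Vertices are added from the sinks upwards, so what a computation reads last is built first.
    let A = tables []
        B = rows (prog A) λ t → provides A (t , tt)
        C = guesses (prog B) λ y → provides B (y , tt)
        D = selection address λ i → provides C (i , tt)
    in reindex (λ _ → tt , correct)
         (relax (≤-reflexive (sizes p (e * 3) (2 ^ 2 ^ s) (2 ^ u) (sharedSize e u s) (2 ^ s))) (A >> B >> C >> D))
    where
    sizes : ∀ p E A U K S → p + (p * (E + U) + (K + A * (p + p * S))) ≡ p * (A * suc S + U + E + 1) + K
    sizes = solve-∀
    entry : ∀ g y z D → lookup (row g y D) (encode z) ≡ lookup D (encode (g ++ (y ++ z)))
    entry g y z D = trans (lookup∘tabulate _ (encode z))
      (cong (λ z′ → lookup D (encode (g ++ (y ++ z′)))) (decode-encode z))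
    correct : ∀ x → addressed (λ i → guessing i x) x ≡ _
    correct x = trans
      (select-diagonal p _ _ λ i i′ →
        lookup (row (read guess x) (read (middle i) x) (read store x)) (encode (read (low i′) x)))
      (select-cong p (λ _ → refl) λ i → cong (matches (read (high i) x) (read guess x) ∧_)
        (entry (read guess x) (read (middle i) x) (read (low i) x) (read store x)))

-- Disjunction over all guesses

any-cong : ∀ {A : Set} {f g : A → Bool} → (∀ x → f x ≡ g x) → ∀ xs → any f xs ≡ any g xs
any-cong f≗g []       = refl
any-cong f≗g (x ∷ xs) = cong₂ _∨_ (f≗g x) (any-cong f≗g xs)

any-false : ∀ {A : Set} (xs : List A) → any (λ _ → false) xs ≡ false
any-false []       = refl
any-false (_ ∷ xs) = any-false xs

any-true : ∀ {A : Set} {f : A → Bool} {x xs} → x ∈ xs → f x ≡ true → any f xs ≡ true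
any-true {f = f} {xs = y ∷ ys} (here refl) fx = cong (_∨ any f ys) fx
any-true {f = f} {xs = y ∷ ys} (there x∈)  fx = trans (cong (f y ∨_) (any-true x∈ fx)) (∨-zeroʳ (f y))

any-∧ : ∀ {A : Set} {c : A → Bool} {xs} → (∃ λ x → x ∈ xs × c x ≡ true) → ∀ d → any (λ x → c x ∧ d) xs ≡ d
any-∧ {c = c} {xs} (x , x∈ , cx) false = trans (any-cong (λ y → ∧-zeroʳ (c y)) xs) (any-false xs)
any-∧ {c = c} {xs} (x , x∈ , cx) true  = any-true x∈ (cong (_∧ true) cx)

-- The address does not depend on the guess, so the disjunction passes into the selected branch.
-- There some guess is verified, and all verified guesses yield the same value.
any-select : ∀ {A : Set} {xs : List A} p a (c : Fin p → A → Bool) (d : Fin p → Bool) →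
             (∀ i → ∃ λ x → x ∈ xs × c i x ≡ true) →
             any (λ x → select p a (λ i → c i x ∧ d i)) xs ≡ select p a d
any-select {xs = xs} zero    a c d some = any-false xs
any-select           (suc p) a c d some with a zero
... | true  = any-∧ (some zero) (d zero)
... | false = any-select p (a ∘ suc) (c ∘ suc) (d ∘ suc) (some ∘ suc)

select-unique : ∀ p {a} (d : Fin p → Bool) i → a i ≡ true → (∀ j → a j ≡ true → j ≡ i) → select p a d ≡ d i
select-unique (suc p) {a} d i ai only with a zero in a₀
... | true  = cong d (only zero a₀)
select-unique (suc p) {a} d zero    ai only | false = contradiction (trans (sym a₀) ai) λ ()
select-unique (suc p) {a} d (suc i) ai only | false =
  select-unique p (d ∘ suc) i ai λ j aj → suc-injective (only (suc j) aj)

matches-refl : ∀ {e} (g : Vec Bool e) → matches g g ≡ true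
matches-refl []          = refl
matches-refl (true ∷ g)  = matches-refl g
matches-refl (false ∷ g) = matches-refl g

matches-subst : ∀ {e} (F : Vec Bool e → Bool) h g → matches h g ∧ F g ≡ matches h g ∧ F h
matches-subst F []          []          = refl
matches-subst F (true ∷ h)  (true ∷ g)  = matches-subst (F ∘ (true ∷_)) h g
matches-subst F (true ∷ h)  (false ∷ g) = refl
matches-subst F (false ∷ h) (true ∷ g)  = refl
matches-subst F (false ∷ h) (false ∷ g) = matches-subst (F ∘ (false ∷_)) h g

tabulate-+ : ∀ {A : Set} m {n} (f : Fin (m + n) → A) →
             tabulate f ≡ tabulate (λ i → f (i ↑ˡ n)) ++ tabulate (λ j → f (m ↑ʳ j))
tabulate-+ zero    f = refl
tabulate-+ (suc m) f = cong (f zero ∷_) (tabulate-+ m (f ∘ suc))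

-- The storage access function and its programs with limited nondeterminism

data Variable (p v : ℕ) : Set where
  addr  : Fin p → Variable p v
  query : Fin p → Fin v → Variable p v
  cell  : Fin (2 ^ v) → Variable p v

arity : ℕ → ℕ → ℕ
arity p v = p + (p * v + 2 ^ v)

module _ {p v : ℕ} where

  index : Variable p v → Fin (arity p v)
  index (addr i)    = i ↑ˡ (p * v + 2 ^ v)
  index (query i j) = p ↑ʳ (combine i j ↑ˡ (2 ^ v))
  index (cell k)    = p ↑ʳ ((p * v) ↑ʳ k)

  variableAt : Fin (arity p v) → Variable p v
  variableAt j = [ addr , [ uncurry query ∘ remQuot v , cell ]′ ∘ splitAt (p * v) ]′ (splitAt p j)

  variableAt-index : ∀ x → variableAt (index x) ≡ x
  variableAt-index (addr i) rewrite splitAt-↑ˡ p i (p * v + 2 ^ v) = refl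
  variableAt-index (query i j) rewrite splitAt-↑ʳ p (p * v + 2 ^ v) (combine i j ↑ˡ (2 ^ v))
    | splitAt-↑ˡ (p * v) (combine i j) (2 ^ v) = cong (uncurry query) (remQuot-combine i j)
  variableAt-index (cell k) rewrite splitAt-↑ʳ p (p * v + 2 ^ v) ((p * v) ↑ʳ k)
    | splitAt-↑ʳ (p * v) (2 ^ v) k = refl

-- The block to be read is addressed in unary, so that p can be any number.
isa : ∀ p v → BoolFn (arity p v)
isa p v x = select p (λ i → bit (addr i)) (λ i → bit (cell (encode (tabulate λ j → bit (query i j)))))
  where
  bit : Variable p v → Bool
  bit y = lookup x (index y)

isa-size : ℕ → ℕ → ℕ → ℕ → ℕ
isa-size p e u s = p * ownSize e u s + sharedSize e u s

-- The program ignores the last `e′` nondeterministic bits: a block of v ≤ δ bits is guessed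
-- completely and leaves δ - v of them over.
isa-realized : ∀ p e u s e′ → ∃ λ k → k ≤ isa-size p e u s ×
               LNBPRealizes (e + e′) (arity p (e + (u + s))) (isa p (e + (u + s))) k
isa-realized p e u s e′ =
  size E , ≤-trans (size≤ E) (≤-reflexive (+-identityʳ _)) , prog E , proj₁ (provides E tt) , correct
  where
  v = e + (u + s)
  n = arity p v
  δ = e + e′

  var : Variable p v → Fin (n + δ)
  var y = index y ↑ˡ δ

  high : Fin p → Vec (Fin (n + δ)) e
  high i = tabulate λ j → var (query i (j ↑ˡ (u + s)))
  middle : Fin p → Vec (Fin (n + δ)) u
  middle i = tabulate λ j → var (query i (e ↑ʳ (j ↑ˡ s)))
  low : Fin p → Vec (Fin (n + δ)) s
  low i = tabulate λ j → var (query i (e ↑ʳ (u ↑ʳ j)))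
  guess : Vec (Fin (n + δ)) e
  guess = tabulate λ j → n ↑ʳ (j ↑ˡ e′)

  E = storageAccess p e u s (var ∘ addr) high middle low guess (tabulate (var ∘ cell))

  read-tabulate : ∀ {q} (f : Fin q → Fin (n + δ)) x → read (tabulate f) x ≡ tabulate (λ j → lookup x (f j))
  read-tabulate f x = sym (tabulate-∘ (lookup x) f)

  module _ (a : Vec Bool n) where
    bit : Variable p v → Bool
    bit y = lookup a (index y)

    bits : ∀ {q} (f : Fin q → Variable p v) b → read (tabulate (var ∘ f)) (a ++ b) ≡ tabulate (bit ∘ f)
    bits f b = trans (read-tabulate (var ∘ f) (a ++ b)) (tabulate-cong λ j → lookup-++ˡ a b (index (f j)))

    guessed : ∀ b → read guess (a ++ b) ≡ tabulate (λ j → lookup b (j ↑ˡ e′))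
    guessed b = trans (read-tabulate _ (a ++ b)) (tabulate-cong λ j → lookup-++ʳ a b (j ↑ˡ e′))

    prefix : Fin p → Vec Bool e
    prefix i = tabulate λ j → bit (query i (j ↑ˡ (u + s)))

    queried : ∀ i b → prefix i ++ (read (middle i) (a ++ b) ++ read (low i) (a ++ b))
                    ≡ tabulate (λ j → bit (query i j))
    queried i b = sym (trans (tabulate-+ e _) (cong (prefix i ++_) (trans (tabulate-+ u _)
      (sym (cong₂ _++_ (bits (λ j → query i (e ↑ʳ (j ↑ˡ s))) b) (bits (λ j → query i (e ↑ʳ (u ↑ʳ j))) b))))))

    verified : Fin p → Vec Bool δ → Bool
    verified i b = matches (prefix i) (read guess (a ++ b))

    witness : ∀ i → ∃ λ b → b ∈ allVecs δ × verified i b ≡ true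
    witness i = b , ∈-allVecs b , trans (cong (matches (prefix i)) (trans (guessed b)
        (trans (tabulate-cong λ j → lookup-++ˡ (prefix i) _ j) (tabulate∘lookup (prefix i))))) (matches-refl (prefix i))
      -- The right guess is the prefix of block i itself; the ignored bits are set to `false`.
      where b = prefix i ++ Vec.replicate e′ false

    accessed : ∀ b → eval (prog E) (a ++ b) (proj₁ (provides E tt)) ≡
      select p (bit ∘ addr) (λ i → verified i b ∧ bit (cell (encode (tabulate λ j → bit (query i j)))))
    accessed b = trans (proj₂ (provides E tt) (a ++ b)) (select-cong p (λ i → lookup-++ˡ a b (index (addr i))) step)
      where
      step : ∀ i → _ ≡ _
      step i = trans
        (cong₂ (λ h l → matches h (read guess (a ++ b)) ∧ l) (bits (λ j → query i (j ↑ˡ (u + s))) b)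
          (trans (lookup-map (encode q) (lookup (a ++ b)) (tabulate (var ∘ cell)))
            (trans (cong (lookup (a ++ b)) (lookup∘tabulate (var ∘ cell) (encode q))) (lookup-++ˡ a b _))))
        -- Where the guess passes the check it equals the prefix, so the index into the store
        -- becomes the whole query.
        (trans (matches-subst
            (λ g → bit (cell (encode (g ++ (read (middle i) (a ++ b) ++ read (low i) (a ++ b))))))
            (prefix i) (read guess (a ++ b)))
          (cong (λ w → verified i b ∧ bit (cell (encode w))) (queried i b)))
        where q = read guess (a ++ b) ++ (read (middle i) (a ++ b) ++ read (low i) (a ++ b))

  correct : ∀ a → isa p v a ≡ any (λ b → eval (prog E) (a ++ b) (proj₁ (provides E tt))) (allVecs δ)
  correct a = sym (trans (any-cong (accessed a) (allVecs δ))
    (any-select p _ (verified a) _ (witness a)))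

-- Many subfunctions on every block of queries

private-block : ∀ {p v} → Variable p v → Fin (suc p)
private-block (query i _) = suc i
private-block _           = zero

-- Each query block is a class of its own; addresses and store together form the class `zero`.
blocks : ∀ p v → Fin (arity p v) → Fin (suc p)
blocks p v j = private-block (variableAt {p} j)

-- The argument in `Fin v` records v ≥ 1, which makes the query classes nonempty.
blocks-partition : ∀ p {v} → Fin v → IsPartition (blocks p v)
blocks-partition p {v} j zero    =
  index {p} (cell (encode (Vec.replicate v false))) , cong private-block (variableAt-index {p} (cell _))
blocks-partition p     j (suc i) =
  index (query i j) , cong private-block (variableAt-index (query i j))

map-≡⇒≗ : ∀ {A B : Set} {f g : A → B} {xs x} → map f xs ≡ map g xs → x ∈ xs → f x ≡ g x
map-≡⇒≗ {xs = _ ∷ _} eq (here refl) = proj₁ (∷-injective eq)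
map-≡⇒≗ {xs = _ ∷ _} eq (there x∈)  = map-≡⇒≗ (proj₂ (∷-injective eq)) x∈

injection-length : ∀ {A : Set} {N} {h : Fin N → A} {ys} → (∀ {k l} → h k ≡ h l → k ≡ l) →
                   (∀ k → h k ∈ ys) → N ≤ length ys
injection-length injective h∈ =
  injective⇒≤ {f = λ k → Any.index (h∈ k)} λ {k} {l} eq →
    injective (Membership.index-injective (setoid _) (h∈ k) (h∈ l) eq)

-- With the address fixed to i and the store to `D`, what remains on block i is the function with
-- truth table `D`, so the 2^2^v stores give distinct subfunctions.
isa-subfunctions : ∀ p v (i : Fin p) → 2 ^ 2 ^ v ≤ r (block (blocks p v) (suc i)) (isa p v)
isa-subfunctions p v i = injection-length {h = λ k → subfunctionTable V (isa p v) (ρ (decode k))} injective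
  λ k → ∈-deduplicate⁺ (≡-dec Bool._≟_) (∈-map⁺ (subfunctionTable V (isa p v)) (∈-allVecs (ρ (decode k))))
  where
  V = block (blocks p v) (suc i)
  n = arity p v

  assign : (Variable p v → Bool) → Vec Bool n
  assign f = tabulate (f ∘ variableAt)

  assigned : ∀ f y → lookup (assign f) (index y) ≡ f y
  assigned f y = trans (lookup∘tabulate _ (index y)) (cong f (variableAt-index y))

  fixed : Vec Bool (2 ^ v) → Variable p v → Bool
  fixed D (addr i′)   = does (i′ Fin.≟ i)
  fixed D (query _ _) = false
  fixed D (cell k)    = lookup D k

  ρ : Vec Bool (2 ^ v) → Vec Bool n
  ρ = assign ∘ fixed

  free : Vec Bool v → Variable p v → Bool
  -- `y` is written into every query block; merging keeps only the copy in block i.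
  free y (query _ j) = lookup y j
  free y _           = false

  merged : ∀ D y x → lookup (merge V (ρ D) (assign (free y))) (index x) ≡
           (if does (private-block x Fin.≟ suc i) then free y x else fixed D x)
  merged D y x = trans (lookup∘tabulate _ (index x))
    (trans (cong (λ b → if b then lookup (assign (free y)) (index x) else lookup (ρ D) (index x))
             (trans (isYes≗does (blocks p v (index x) Fin.≟ suc i))
               (cong (λ w → does (private-block w Fin.≟ suc i)) (variableAt-index x))))
           (cong₂ (if does (private-block x Fin.≟ suc i) then_else_) (assigned (free y) x) (assigned (fixed D) x)))

  own : ∀ D y j → lookup (merge V (ρ D) (assign (free y))) (index (query i j)) ≡ lookup y j
  own D y j = trans (merged D y (query i j))
    (cong (if_then lookup y j else false) (dec-true (suc i Fin.≟ suc i) refl))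

  value : ∀ D y → isa p v (merge V (ρ D) (assign (free y))) ≡ lookup D (encode y)
  value D y = trans
    (select-unique p _ i (trans (merged D y (addr i)) (dec-true (i Fin.≟ i) refl)) only)
    (trans (merged D y (cell _)) (cong (lookup D ∘ encode) (trans (tabulate-cong (own D y)) (tabulate∘lookup y))))
    where
    only : ∀ j → lookup (merge V (ρ D) (assign (free y))) (index (addr j)) ≡ true → j ≡ i
    only j eq with j Fin.≟ i | merged D y (addr j)
    ... | yes j≡i | _ = j≡i
    ... | no _    | m = contradiction (trans (sym m) eq) λ ()

  injective : ∀ {k l} → subfunctionTable V (isa p v) (ρ (decode k)) ≡ subfunctionTable V (isa p v) (ρ (decode l)) →
              k ≡ l
  injective {k} {l} eq = trans (sym (encode-decode {2 ^ v} k)) (trans (cong encode same) (encode-decode {2 ^ v} l))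
    where
    at : ∀ y → lookup (decode k) (encode y) ≡ lookup (decode l) (encode y)
    -- Equal tables agree in particular at `free y`, which probes the store at `y`.
    at y = trans (sym (value (decode k) y)) (trans (map-≡⇒≗ eq (∈-allVecs (assign (free y)))) (value (decode l) y))
    same : decode k ≡ decode l
    same = trans (sym (tabulate∘lookup (decode k))) (trans (tabulate-cong λ j →
      subst (λ j → lookup (decode k) j ≡ lookup (decode l) j) (encode-decode {v} j) (at (decode j)))
      (tabulate∘lookup (decode l)))

-- Counting subfunctions

count : ∀ {n} → (Fin n → Bool) → ℕ
count {zero}  V = 0
count {suc n} V = (if V zero then 1 else 0) + count (V ∘ suc)

-- The length is the conditional from `count`, so `restrict` and `extend` type-check by unfolding
-- alone.
push : ∀ {k} c → Bool → Vec Bool k → Vec Bool ((if c then 1 else 0) + k)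
push true  b y = b ∷ y
push false b y = y

pop : ∀ {k} c → Vec Bool ((if c then 1 else 0) + k) → Bool × Vec Bool k
pop true  (b ∷ y) = b , y
pop false y       = false , y

pop-push : ∀ {k} c b (y : Vec Bool k) → pop c (push c b y) ≡ ((if c then b else false) , y)
pop-push true  b y = refl
pop-push false b y = refl

restrict : ∀ {n} (V : Fin n → Bool) → Vec Bool n → Vec Bool (count V)
restrict V []      = []
restrict V (b ∷ z) = push (V zero) b (restrict (V ∘ suc) z)

extend : ∀ {n} (V : Fin n → Bool) → Vec Bool (count V) → Vec Bool n
extend {zero}  V y = []
extend {suc n} V y = let (b , y′) = pop (V zero) y in b ∷ extend (V ∘ suc) y′

extend-restrict : ∀ {n} (V : Fin n → Bool) z j → V j ≡ true → lookup (extend V (restrict V z)) j ≡ lookup z j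
extend-restrict V (b ∷ z) j Vj rewrite pop-push (V zero) b (restrict (V ∘ suc) z) with j
... | zero rewrite Vj = refl
... | suc j′ = extend-restrict (V ∘ suc) z j′ Vj

-- `extend` invents values only outside V, and there `merge` consults `ρ`.
merge-restrict : ∀ {n} (V : Fin n → Bool) ρ z → merge V ρ (extend V (restrict V z)) ≡ merge V ρ z
merge-restrict V ρ z = tabulate-cong pointwise
  where
  pointwise : ∀ j → (if V j then lookup (extend V (restrict V z)) j else lookup ρ j)
                    ≡ (if V j then lookup z j else lookup ρ j)
  pointwise j with V j in Vj
  ... | true  = extend-restrict V z j Vj
  ... | false = refl

lookup-injective : ∀ {A : Set} {xs : List A} → Unique xs → ∀ i j → List.lookup xs i ≡ List.lookup xs j → i ≡ j
lookup-injective (x∉ ∷ u) zero    zero    eq = refl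
lookup-injective (x∉ ∷ u) zero    (suc j) eq = contradiction eq (All.lookup x∉ (∈-lookup j))
lookup-injective (x∉ ∷ u) (suc i) zero    eq = contradiction (sym eq) (All.lookup x∉ (∈-lookup i))
lookup-injective (x∉ ∷ u) (suc i) (suc j) eq = cong suc (lookup-injective u i j eq)

module _ {n} (V : Fin n → Bool) (f : BoolFn n) where

  private tables = map (subfunctionTable V f) (allVecs n)

  r-positive : 1 ≤ r V f
  r-positive = ∈-length (∈-deduplicate⁺ (≡-dec Bool._≟_)
    (∈-map⁺ (subfunctionTable V f) (∈-allVecs (Vec.replicate n false))))

  -- Each subfunction comes from some `ρ`. For n ≤ 2^t this caps `r` at 2^2^t, so a block counts for
  -- at most t variables.
  r≤2^n : r V f ≤ 2 ^ n
  r≤2^n = ≤-trans (length-deduplicate (≡-dec Bool._≟_) tables)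
    (≤-reflexive (trans (length-map _ (allVecs n)) (length-allVecs n)))

  -- A subfunction on V is determined by 2^|V| values, from which `inflate` recovers its table over
  -- all n variables.
  r≤2^2^count : r V f ≤ 2 ^ 2 ^ count V
  r≤2^2^count = ≤-trans
    (injection-length {h = List.lookup (deduplicate (≡-dec Bool._≟_) tables)}
      (lookup-injective (deduplicate-! tables) _ _)
      λ i → covered (∈-deduplicate⁻ (≡-dec Bool._≟_) tables (∈-lookup i)))
    (≤-reflexive (trans (length-map _ (allVecs (2 ^ count V))) (length-allVecs (2 ^ count V))))
    where
    inflate : Vec Bool (2 ^ count V) → List Bool
    inflate T = map (λ z → lookup T (encode (restrict V z))) (allVecs n)
    table≡ : ∀ ρ → subfunctionTable V f ρ ≡ inflate (tabulate λ k → f (merge V ρ (extend V (decode k))))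
    table≡ ρ = map-cong (λ z → sym (trans (lookup∘tabulate _ (encode (restrict V z)))
      (cong f (trans (cong (merge V ρ ∘ extend V) (decode-encode (restrict V z))) (merge-restrict V ρ z))))) (allVecs n)
    covered : ∀ {t} → t ∈ tables → t ∈ map inflate (allVecs (2 ^ count V))
    covered t∈ with ∈-map⁻ (subfunctionTable V f) t∈
    ... | ρ , _ , refl = subst (_∈ map inflate (allVecs (2 ^ count V))) (sym (table≡ ρ))
      (∈-map⁺ inflate (∈-allVecs (tabulate λ k → f (merge V ρ (extend V (decode k))))))

-- Sums over the blocks of a partition

-- In this form the sum over p + 1 indices unfolds to a first term and a sum of the same form.
sumOver : ∀ p → (Fin p → ℕ) → ℕ
sumOver p g = sum (List.tabulate g)

necSum≡ : ∀ {n p} b (f : BoolFn n) (c : Fin n → Fin p) → necSum b f c ≡ sumOver p (λ i → b (r (block c i) f))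
necSum≡ {p = p} b f c = cong sum (map-tabulate id (λ i → b (r (block c i) f)))

sumOver-lower : ∀ p {g : Fin p → ℕ} {m} → (∀ i → m ≤ g i) → p * m ≤ sumOver p g
sumOver-lower zero    m≤g = z≤n
sumOver-lower (suc p) m≤g = +-mono-≤ (m≤g zero) (sumOver-lower p (m≤g ∘ suc))

sumOver-scale : ∀ p {g w : Fin p → ℕ} {x y} → (∀ i → g i * x ≤ w i * y) → sumOver p g * x ≤ sumOver p w * y
sumOver-scale zero    le = z≤n
sumOver-scale (suc p) {g} {w} {x} {y} le = ≤-trans (≤-reflexive (*-distribʳ-+ x (g zero) _))
  (≤-trans (+-mono-≤ (le zero) (sumOver-scale p (le ∘ suc))) (≤-reflexive (sym (*-distribʳ-+ y (w zero) _))))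

sumOver-zero : ∀ p → sumOver p (λ _ → 0) ≡ 0
sumOver-zero zero    = refl
sumOver-zero (suc p) = sumOver-zero p

sumOver-+ : ∀ p (g h : Fin p → ℕ) → sumOver p (λ i → g i + h i) ≡ sumOver p g + sumOver p h
sumOver-+ zero    g h = refl
sumOver-+ (suc p) g h = trans (cong (g zero + h zero +_) (sumOver-+ p (g ∘ suc) (h ∘ suc))) (interchange (g zero) _ _ _)
  where
  interchange : ∀ a b c d → a + b + (c + d) ≡ a + c + (b + d)
  interchange = solve-∀

sumOver-cong : ∀ p {g h : Fin p → ℕ} → (∀ i → g i ≡ h i) → sumOver p g ≡ sumOver p h
sumOver-cong zero    g≗h = refl
sumOver-cong (suc p) g≗h = cong₂ _+_ (g≗h zero) (sumOver-cong p (g≗h ∘ suc))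

sumOver-indicator : ∀ {p} (j : Fin p) → sumOver p (λ i → if does (j Fin.≟ i) then 1 else 0) ≡ 1
sumOver-indicator {suc p} zero    = cong suc (sumOver-zero p)
sumOver-indicator {suc p} (suc j) = sumOver-indicator j

-- By induction on the variables, each of which contributes 1 to exactly one block.
count-blocks : ∀ {n p} (c : Fin n → Fin p) → sumOver p (λ i → count (block c i)) ≡ n
count-blocks {zero}  {p} c = sumOver-zero p
count-blocks {suc n} {p} c = trans
  (sumOver-+ p (λ i → if block c i zero then 1 else 0) (λ i → count (block (c ∘ suc) i)))
  (cong₂ _+_ (trans (sumOver-cong p λ i → cong (λ b → if b then 1 else 0) (isYes≗does (c zero Fin.≟ i)))
                    (sumOver-indicator (c zero)))
             (count-blocks (c ∘ suc)))

count-positive : ∀ {n} (V : Fin n → Bool) j → V j ≡ true → 1 ≤ count V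
count-positive V zero    Vj rewrite Vj = s≤s z≤n
count-positive V (suc j) Vj = ≤-trans (count-positive (V ∘ suc) j Vj) (m≤n+m _ _)

-- Upper bound on Nečiporuk functions from storage access

neciporuk-bound : ∀ {δ b} → IsNeciporuk (LNBPRealizes δ) b → ∀ e u s e′ → δ ≡ e + e′ → Fin (e + (u + s)) →
                  b (2 ^ 2 ^ (e + (u + s))) ≤ ownSize e u s
neciporuk-bound {b = b} (mono , lower) e u s e′ refl j = s≤s⁻¹ (*-cancelˡ-< p _ _ (begin-strict
  p * b (2 ^ 2 ^ v)
    ≤⟨ sumOver-lower p (λ i → mono _ _ (m^n>0 2 (2 ^ v)) (isa-subfunctions p v i)) ⟩
  sumOver p (λ i → b (r (block c (suc i)) (isa p v)))     ≤⟨ m≤n+m _ (b (r (block c zero) (isa p v))) ⟩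
  sumOver (suc p) (λ i → b (r (block c i) (isa p v)))     ≡⟨ necSum≡ b (isa p v) c ⟨
  necSum b (isa p v) c
    ≤⟨ lower _ (isa p v) _ c (blocks-partition p j) k realized ⟩
  k                                                       ≤⟨ k≤ ⟩
  p * ownSize e u s + sharedSize e u s                    <⟨ +-monoʳ-< (p * ownSize e u s) (n<1+n _) ⟩
  p * ownSize e u s + p                                   ≡⟨ +-comm _ p ⟩
  p + p * ownSize e u s                                   ≡⟨ *-suc p (ownSize e u s) ⟨
  p * suc (ownSize e u s)                                 ∎))
  where
  v = e + (u + s)
  -- The shared cost does not grow with the number of blocks, so p may exceed it. Then p · b ≤ p ·
  -- own + shared < p · (own + 1), and p cancels.
  p = suc (sharedSize e u s)
  c = blocks p v
  k = proj₁ (isa-realized p e u s e′)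
  k≤ = proj₁ (proj₂ (isa-realized p e u s e′))
  realized = proj₂ (proj₂ (isa-realized p e u s e′))

-- Asymptotics

square≤2^ : ∀ q → q * q ≤ 2 * 2 ^ q
square≤2^ 0 = z≤n
square≤2^ 1 = m≤m+n 1 3
square≤2^ 2 = m≤m+n 4 4
square≤2^ 3 = m≤m+n 9 7
square≤2^ (suc q@(suc (suc (suc j)))) = begin
  -- For q = 3 + j, 2q² exceeds (q + 1)² by 2 + 4j + j², so doubling suffices; the smaller cases are
  -- checked directly.
  suc q * suc q                        ≤⟨ m≤m+n _ (2 + 4 * j + j * j) ⟩
  suc q * suc q + (2 + 4 * j + j * j)  ≡⟨ expand j ⟩
  2 * (q * q)                          ≤⟨ *-monoʳ-≤ 2 (square≤2^ q) ⟩
  2 * (2 * 2 ^ q)                      ∎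
  where
  expand : ∀ j → (4 + j) * (4 + j) + (2 + 4 * j + j * j) ≡ 2 * ((3 + j) * (3 + j))
  expand = solve-∀

-- The choice of s with 2^s between (w + 1)/4 and (w + 1)/2. The upper limit keeps the 2^2^s tables
-- cheap, the lower one makes the middle tree of 2^(w - s) vertices O(2^w / w).
tableHeight : ∀ w → 1 ≤ w → ∃ λ s → s ≤ w × 2 * 2 ^ s ≤ suc w × suc w ≤ 4 * 2 ^ s
tableHeight 1 _ = 0 , z≤n , ≤-refl , m≤m+n 2 2
tableHeight (suc w@(suc _)) _ with tableHeight w (s≤s z≤n)
... | s , s≤w , lower , upper with suc (suc w) ≤? 4 * 2 ^ s
...   | yes fits = s , m≤n⇒m≤1+n s≤w , m≤n⇒m≤1+n lower , fits
...   | no  full = suc s , s≤s s≤w ,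
  ≤-trans (≤-reflexive (regroup (2 ^ s))) (≤-trans (s≤s⁻¹ (≰⇒> full)) (n≤1+n _)) , (begin
  suc (suc w)          ≤⟨ s≤s upper ⟩
  suc (4 * 2 ^ s)      ≤⟨ +-monoˡ-≤ (4 * 2 ^ s) (≤-trans (m^n>0 2 s) (m≤n*m (2 ^ s) 4)) ⟩
  4 * 2 ^ s + 4 * 2 ^ s ≡⟨ double (2 ^ s) ⟩
  4 * (2 * 2 ^ s)      ∎)
  where
  regroup : ∀ q → 2 * (2 * q) ≡ 4 * q
  regroup = solve-∀
  double : ∀ q → 4 * q + 4 * q ≡ 4 * (2 * q)
  double = solve-∀

tableSize : ℕ → ℕ → ℕ
tableSize u s = 2 ^ 2 ^ s * suc (2 ^ s) + 2 ^ u

-- With q = 2^s, the tables contribute 8q² · 2^q ≤ 16 · 2^(2q) ≤ 32 · 2^w and the middle tree 4q ·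
-- 2^u = 4 · 2^w.
tableSize-bound : ∀ u s → 2 * 2 ^ s ≤ suc (u + s) → suc (u + s) ≤ 4 * 2 ^ s →
                  (u + s) * tableSize u s ≤ 36 * 2 ^ (u + s)
tableSize-bound u s lower upper = begin
  w * (2 ^ q * suc q + 2 ^ u)
    ≤⟨ *-mono-≤ w≤4q (+-monoˡ-≤ (2 ^ u) (*-monoʳ-≤ (2 ^ q) 1+q≤2q)) ⟩
  4 * q * (2 ^ q * (2 * q) + 2 ^ u)               ≡⟨ expand q (2 ^ q) (2 ^ u) ⟩
  8 * (q * q) * 2 ^ q + 4 * (2 ^ u * q)
    ≤⟨ +-monoˡ-≤ _ (*-monoˡ-≤ (2 ^ q) (*-monoʳ-≤ 8 (square≤2^ q))) ⟩
  8 * (2 * 2 ^ q) * 2 ^ q + 4 * (2 ^ u * q)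
    ≡⟨ cong₂ _+_ (regroup (2 ^ q)) (cong (4 *_) (sym (^-distribˡ-+-* 2 u s))) ⟩
  16 * (2 ^ q * 2 ^ q) + 4 * 2 ^ w                ≡⟨ cong (λ z → 16 * z + 4 * 2 ^ w) (^-distribˡ-+-* 2 q q) ⟨
  16 * 2 ^ (q + q) + 4 * 2 ^ w                    ≤⟨ +-monoˡ-≤ _ (*-monoʳ-≤ 16 (^-monoʳ-≤ 2 2q≤1+w)) ⟩
  16 * (2 * 2 ^ w) + 4 * 2 ^ w                    ≡⟨ collect (2 ^ w) ⟩
  36 * 2 ^ w                                      ∎
  where
  w = u + s
  q = 2 ^ s
  w≤4q : w ≤ 4 * q
  w≤4q = ≤-trans (n≤1+n w) upper
  1+q≤2q : suc q ≤ 2 * q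
  1+q≤2q = +-mono-≤ (m^n>0 2 s) (≤-reflexive (sym (+-identityʳ q)))
  2q≤1+w : q + q ≤ suc w
  2q≤1+w = ≤-trans (≤-reflexive (cong (q +_) (sym (+-identityʳ q)))) lower
  expand : ∀ q E U → 4 * q * (E * (2 * q) + U) ≡ 8 * (q * q) * E + 4 * (U * q)
  expand = solve-∀
  regroup : ∀ E → 8 * (2 * E) * E ≡ 16 * (E * E)
  regroup = solve-∀
  collect : ∀ W → 16 * (2 * W) + 4 * W ≡ 36 * W
  collect = solve-∀

-- Cost of a block in proportion to its number of variables

m+n≤m*1+n : ∀ {m} n → 1 ≤ m → m + n ≤ m * suc n
m+n≤m*1+n {m} n 1≤m = ≤-trans
  (+-monoʳ-≤ m (≤-trans (≤-reflexive (sym (*-identityˡ n))) (*-monoˡ-≤ n 1≤m)))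
  (≤-reflexive (sym (*-suc m n)))

-- With t = v + d and denominators cleared, `G` is at most v times the rate 144 · 2^t / (2^δ (t - δ)
-- t). The rate depends on t and δ only, so such bounds can be summed over blocks of different
-- sizes.
LevelBound : ℕ → (ℕ → ℕ) → ℕ → Set
LevelBound δ b v = ∃ λ G → b (2 ^ 2 ^ v) ≤ 9 * v + G ×
  (∀ d → G * (2 ^ δ * ((v + d ∸ δ) * (v + d))) ≤ v * (144 * 2 ^ (v + d)))

module _ {δ b} (nec : IsNeciporuk (LNBPRealizes δ) b) where

  -- All v bits can be guessed. With u = s = 0 a block costs 3v + 6, which is linear in v, and `G`
  -- can be 0.
  low-level-bound : ∀ v → 1 ≤ v → v ≤ δ → LevelBound δ b v
  low-level-bound v 1≤v v≤δ = 0 , (begin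
    b (2 ^ 2 ^ v)          ≡⟨ cong (λ z → b (2 ^ 2 ^ z)) (+-identityʳ v) ⟨
    b (2 ^ 2 ^ (v + 0))
      ≤⟨ neciporuk-bound nec v 0 0 (δ ∸ v) (sym (m+[n∸m]≡n v≤δ)) (fromℕ< (≤-trans 1≤v (m≤m+n v 0))) ⟩
    ownSize v 0 0          ≡⟨ evaluate v ⟩
    6 * 1 + 3 * v          ≤⟨ +-monoˡ-≤ (3 * v) (*-monoʳ-≤ 6 1≤v) ⟩
    6 * v + 3 * v          ≡⟨ collect v ⟩
    9 * v + 0              ∎) , λ _ → z≤n
    where
    evaluate : ∀ v → 2 * 2 + 1 + v * 3 + 1 ≡ 6 * 1 + 3 * v
    evaluate = solve-∀
    collect : ∀ v → 6 * v + 3 * v ≡ 9 * v + 0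
    collect = solve-∀

  -- Passing from v to t = v + d enlarges (v - δ)v by a factor of at most (d + 1)², which the growth
  -- 2^d of the right side absorbs up to the constant 4; this turns 36 into 144.
  high-level-bound : ∀ u s → 1 ≤ u + s → 2 * 2 ^ s ≤ suc (u + s) → suc (u + s) ≤ 4 * 2 ^ s →
                     LevelBound δ b (δ + (u + s))
  high-level-bound u s 1≤w lower upper = G , (begin
    b (2 ^ 2 ^ v)            ≤⟨ neciporuk-bound nec δ u s 0 (sym (+-identityʳ δ)) (fromℕ< 1≤v) ⟩
    G + δ * 3 + 1            ≤⟨ +-monoʳ-≤ (G + δ * 3) 1≤v ⟩
    G + δ * 3 + v            ≤⟨ +-monoˡ-≤ v (+-monoʳ-≤ G (*-mono-≤ (m≤m+n δ w) (m≤m+n 3 5))) ⟩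
    G + v * 8 + v            ≡⟨ collect G v ⟩
    9 * v + G                ∎) , λ d → begin
    G * (2 ^ δ * ((v + d ∸ δ) * (v + d)))
      ≡⟨ cong (λ z → G * (2 ^ δ * (z * (v + d)))) (trans (cong (_∸ δ) (+-assoc δ w d)) (m+n∸m≡n δ (w + d))) ⟩
    G * (2 ^ δ * ((w + d) * (v + d)))
      ≤⟨ *-monoʳ-≤ G (*-monoʳ-≤ (2 ^ δ) (*-mono-≤ (m+n≤m*1+n d 1≤w) (m+n≤m*1+n d 1≤v))) ⟩
    G * (2 ^ δ * (w * suc d * (v * suc d)))          ≡⟨ regroup G (2 ^ δ) w v (suc d) ⟩
    w * G * (2 ^ δ * (v * (suc d * suc d)))
      ≤⟨ *-mono-≤ (tableSize-bound u s lower upper) (*-monoʳ-≤ (2 ^ δ) (*-monoʳ-≤ v (square≤2^ (suc d)))) ⟩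
    36 * 2 ^ w * (2 ^ δ * (v * (2 * (2 * 2 ^ d))))   ≡⟨ regroup′ (2 ^ w) (2 ^ δ) v (2 ^ d) ⟩
    v * (144 * (2 ^ δ * 2 ^ w * 2 ^ d))
      ≡⟨ cong (λ z → v * (144 * z)) (trans (cong (_* 2 ^ d) (sym (^-distribˡ-+-* 2 δ w))) (sym (^-distribˡ-+-* 2 v d))) ⟩
    v * (144 * 2 ^ (v + d))                          ∎
    where
    w = u + s
    v = δ + w
    G = tableSize u s
    1≤v : 1 ≤ v
    1≤v = ≤-trans 1≤w (m≤n+m w δ)
    collect : ∀ t v → t + v * 8 + v ≡ 9 * v + t
    collect = solve-∀
    regroup : ∀ G A w v d → G * (A * (w * d * (v * d))) ≡ w * G * (A * (v * (d * d)))
    regroup = solve-∀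
    regroup′ : ∀ W A v D → 36 * W * (A * (v * (2 * (2 * D)))) ≡ v * (144 * (A * W * D))
    regroup′ = solve-∀

  level-bound : ∀ v → 1 ≤ v → LevelBound δ b v
  level-bound v 1≤v with v ≤? δ
  ... | yes v≤δ = low-level-bound v 1≤v v≤δ
  ... | no  v≰δ =
    let δ<v = ≰⇒> v≰δ
        s , s≤w , lower , upper = tableHeight (v ∸ δ) (m<n⇒0<n∸m δ<v)
        w≡ = m∸n+n≡m s≤w
    in subst (LevelBound δ b) (trans (cong (δ +_) w≡) (m+[n∸m]≡n (<⇒≤ δ<v)))
         (high-level-bound (v ∸ δ ∸ s) s (subst (1 ≤_) (sym w≡) (m<n⇒0<n∸m δ<v))
           (subst (λ w → 2 * 2 ^ s ≤ suc w) (sym w≡) lower) (subst (λ w → suc w ≤ 4 * 2 ^ s) (sym w≡) upper))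

  module _ {n p} (f : BoolFn n) (c : Fin n → Fin p) (partition : IsPartition c)
           (t : ℕ) (1≤t : 1 ≤ t) (n≤2^t : n ≤ 2 ^ t) where

    private
      Q = 2 ^ δ * ((t ∸ δ) * t)

      blockSize : Fin p → ℕ
      blockSize i = count (block c i)

      nonempty : ∀ i → 1 ≤ blockSize i
      nonempty i = let (j , cj≡i) = partition i in
        count-positive (block c i) j (trans (isYes≗does (c j Fin.≟ i)) (dec-true (c j Fin.≟ i) cj≡i))

      capped : ∀ i → r (block c i) f ≤ 2 ^ 2 ^ (blockSize i ⊓ t)
      capped i with ⊓-sel (blockSize i) t
      ... | inj₁ eq = subst (λ v → r (block c i) f ≤ 2 ^ 2 ^ v) (sym eq) (r≤2^2^count (block c i) f)
      ... | inj₂ eq = subst (λ v → r (block c i) f ≤ 2 ^ 2 ^ v) (sym eq)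
        (≤-trans (r≤2^n (block c i) f) (^-monoʳ-≤ 2 n≤2^t))

      -- Every block pays at most a common rate per variable, so the total is n times that rate.
      block-bound : ∀ i → b (r (block c i) f) * Q ≤ blockSize i * (9 * Q + 144 * 2 ^ t)
      block-bound i with level-bound (blockSize i ⊓ t) (⊓-glb (nonempty i) 1≤t)
      ... | G , b≤ , G≤ = begin
        b (r (block c i) f) * Q
          ≤⟨ *-monoˡ-≤ Q (≤-trans (proj₁ nec _ _ (r-positive (block c i) f) (capped i)) b≤) ⟩
        (9 * v + G) * Q                              ≡⟨ expand v G Q ⟩
        v * (9 * Q) + G * Q
          -- The level bound is taken at d = t - v; this is where v ≤ t, that is the cap, enters.
          ≤⟨ +-monoʳ-≤ (v * (9 * Q)) (subst (λ t → G * (2 ^ δ * ((t ∸ δ) * t)) ≤ v * (144 * 2 ^ t))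
               (m+[n∸m]≡n (m⊓n≤n (blockSize i) t)) (G≤ (t ∸ v))) ⟩
        v * (9 * Q) + v * (144 * 2 ^ t)              ≡⟨ *-distribˡ-+ v (9 * Q) _ ⟨
        v * (9 * Q + 144 * 2 ^ t)
          ≤⟨ *-monoˡ-≤ (9 * Q + 144 * 2 ^ t) (m⊓n≤m (blockSize i) t) ⟩
        blockSize i * (9 * Q + 144 * 2 ^ t)               ∎
        where
        v = blockSize i ⊓ t
        expand : ∀ v G Q → (9 * v + G) * Q ≡ v * (9 * Q) + G * Q
        expand = solve-∀

    necSum-bound : necSum b f c * (2 ^ δ * ((t ∸ δ) * t)) ≤ n * (9 * (2 ^ δ * ((t ∸ δ) * t)) + 144 * 2 ^ t)
    necSum-bound = begin
      necSum b f c * Q                                   ≡⟨ cong (_* Q) (necSum≡ b f c) ⟩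
      sumOver p (λ i → b (r (block c i) f)) * Q          ≤⟨ sumOver-scale p block-bound ⟩
      sumOver p blockSize * (9 * Q + 144 * 2 ^ t)
        ≡⟨ cong (_* (9 * Q + 144 * 2 ^ t)) (count-blocks c) ⟩
      n * (9 * Q + 144 * 2 ^ t)                          ∎

-- The bounds in terms of log₂ n

bitLength : ∀ n → 1 ≤ n → ∃ λ t → 1 ≤ t × n < 2 ^ t × 2 ^ t ≤ 2 * n
bitLength 1 _ = 1 , ≤-refl , ≤-refl , ≤-refl
bitLength (suc n@(suc _)) _ with bitLength n (s≤s z≤n)
... | t , 1≤t , n< , ≤2n with suc n <? 2 ^ t
...   | yes fits = t , 1≤t , fits , ≤-trans ≤2n (*-monoʳ-≤ 2 (n≤1+n n))
...   | no  full = suc t , m≤n⇒m≤1+n 1≤t ,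
  +-mono-≤ (m^n>0 2 t) (≤-trans n< (m≤m+n (2 ^ t) 0)) , *-monoʳ-≤ 2 (≮⇒≥ full)

-- A rational a/b below log₂ n is also below t, so the integer t can stand in for log₂ n.
exponent-bound : ∀ {n t} a b → n < 2 ^ t → 2 ^ a < n ^ b → a ≤ t * b
exponent-bound {n} {t} a b n<2^t 2^a<n^b = ≮⇒≥ λ tb<a → <-irrefl refl (begin-strict
  2 ^ (t * b)    <⟨ ^-monoʳ-< 2 ≤-refl tb<a ⟩
  2 ^ a          <⟨ 2^a<n^b ⟩
  n ^ b          ≤⟨ ^-monoˡ-≤ b (<⇒≤ n<2^t) ⟩
  (2 ^ t) ^ b    ≡⟨ ^-*-assoc 2 t b ⟩
  2 ^ (t * b)    ∎)

-- Either the linear part 9n of the bound is at most half of L, and is absorbed, or L is linear in n.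
Γ-bound : ∀ {L n Q t} → L * Q ≤ n * (9 * Q + 144 * 2 ^ t) → 2 ^ t ≤ 2 * n → 576 * n ≤ L → L * Q ≤ 576 * (n * n)
Γ-bound {L} {n} {Q} {t} LQ≤ 2^t≤2n 576n≤L = +-cancelˡ-≤ (L * Q) _ _ (begin
  L * Q + L * Q                             ≤⟨ +-mono-≤ LQ≤ LQ≤ ⟩
  n * (9 * Q + 144 * 2 ^ t) + n * (9 * Q + 144 * 2 ^ t)   ≡⟨ regroup n Q (2 ^ t) ⟩
  18 * n * Q + 288 * n * 2 ^ t
    ≤⟨ +-mono-≤ (*-monoˡ-≤ Q (≤-trans (*-monoˡ-≤ n (m≤m+n 18 558)) 576n≤L)) (*-monoʳ-≤ (288 * n) 2^t≤2n) ⟩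
  L * Q + 288 * n * (2 * n)                 ≡⟨ cong (L * Q +_) (collect n) ⟩
  L * Q + 576 * (n * n)                     ∎)
  where
  regroup : ∀ n Q T → n * (9 * Q + 144 * T) + n * (9 * Q + 144 * T) ≡ 18 * n * Q + 288 * n * T
  regroup = solve-∀
  collect : ∀ n → 288 * n * (2 * n) ≡ 576 * (n * n)
  collect = solve-∀

LNBP-bound : ∀ {δ b n p} → IsNeciporuk (LNBPRealizes δ) b → 1 ≤ n → (f : BoolFn n) (c : Fin n → Fin p) →
             IsPartition c → LeqCΓ 576 (necSum b f c) n δ
LNBP-bound {δ} {b} {n} nec 1≤n f c partition = superlinear , linear
  where
  L = necSum b f c

  linear : n < 2 ^ (δ + 1) → L ≤ 576 * n
  -- For t = δ + 1 the factor t - δ is 1, so Q ≥ 2^δ and 144 · 2^t ≤ 288 Q; together with 9Q this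
  -- gives 297.
  linear n< = *-cancelʳ-≤ L (576 * n) Q {{>-nonZero (≤-trans (m^n>0 2 δ) 2^δ≤Q)}} (begin
    L * Q                                ≤⟨ necSum-bound nec f c partition (δ + 1) (m≤n+m 1 δ) (<⇒≤ n<) ⟩
    n * (9 * Q + 144 * 2 ^ (δ + 1))      ≡⟨ cong (λ z → n * (9 * Q + 144 * z)) (^-distribˡ-+-* 2 δ 1) ⟩
    n * (9 * Q + 144 * (2 ^ δ * 2))
      ≤⟨ *-monoʳ-≤ n (+-monoʳ-≤ (9 * Q) (*-monoʳ-≤ 144 (*-monoˡ-≤ 2 2^δ≤Q))) ⟩
    n * (9 * Q + 144 * (Q * 2))          ≡⟨ collect n Q ⟩
    297 * n * Q                          ≤⟨ *-monoˡ-≤ Q (*-monoˡ-≤ n (m≤m+n 297 279)) ⟩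
    576 * n * Q                          ∎)
    where
    Q = 2 ^ δ * ((δ + 1 ∸ δ) * (δ + 1))
    2^δ≤Q : 2 ^ δ ≤ Q
    2^δ≤Q = ≤-trans (≤-reflexive (sym (*-identityʳ (2 ^ δ)))) (*-monoʳ-≤ (2 ^ δ)
      (*-mono-≤ (≤-reflexive (sym (m+n∸m≡n δ 1))) (m≤n+m 1 δ)))
    collect : ∀ n Q → n * (9 * Q + 144 * (Q * 2)) ≡ 297 * n * Q
    collect = solve-∀

  superlinear : 2 ^ (δ + 1) ≤ n → _
  superlinear _ with L ≤? 576 * n | bitLength n 1≤n
  ... | yes L≤ | _ = inj₁ L≤
  ... | no  L≰ | t , 1≤t , n< , 2^t≤2n = inj₂ λ a q _ _ 2^a<n^q →
    let a≤tq = exponent-bound {n} {t} a q n< 2^a<n^q in begin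
    L * 2 ^ δ * (a ∸ δ * q) * a
      -- The left side grows with a, so a may be raised to tq; then q² splits off and `Γ-bound`
      -- applies.
      ≤⟨ *-mono-≤ (*-monoʳ-≤ (L * 2 ^ δ) (∸-monoˡ-≤ (δ * q) a≤tq)) a≤tq ⟩
    L * 2 ^ δ * (t * q ∸ δ * q) * (t * q)      ≡⟨ cong (λ z → L * 2 ^ δ * z * (t * q)) (*-distribʳ-∸ q t δ) ⟨
    L * 2 ^ δ * ((t ∸ δ) * q) * (t * q)        ≡⟨ regroup L (2 ^ δ) (t ∸ δ) t q ⟩
    L * (2 ^ δ * ((t ∸ δ) * t)) * q ^ 2
      ≤⟨ *-monoˡ-≤ (q ^ 2) (Γ-bound {n = n} {t = t} (necSum-bound nec f c partition t 1≤t (<⇒≤ n<)) 2^t≤2n (≰⇒≥ L≰)) ⟩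
    576 * (n * n) * q ^ 2                      ≡⟨ cong (λ z → 576 * (n * z) * q ^ 2) (*-identityʳ n) ⟨
    576 * n ^ 2 * q ^ 2                        ∎
    where
    regroup : ∀ L A d t q → L * A * (d * q) * (t * q) ≡ L * (A * (d * t)) * (q * (q * 1))
    regroup = solve-∀

-- Deterministic branching programs as the case δ = 0

rename : ∀ {m m′ k} → (Fin m → Fin m′) → Prog m k → Prog m′ k
rename σ []              = []
rename σ (node v t₀ t₁ P) = node (σ v) t₀ t₁ (rename σ P)

eval-rename : ∀ {m m′ k} {σ : Fin m → Fin m′} {x y} → (∀ i → lookup y (σ i) ≡ lookup x i) →
              ∀ (P : Prog m k) s → eval (rename σ P) y s ≡ eval P x s
eval-rename y∘σ≗x P                 (inj₁ b)       = refl
eval-rename y∘σ≗x (node v t₀ t₁ P) (inj₂ (suc j)) = eval-rename y∘σ≗x P (inj₂ j)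
eval-rename {σ = σ} {x} {y} y∘σ≗x (node v t₀ t₁ P) (inj₂ zero) =
  trans (cong (λ b → eval (rename σ P) y (if b then t₁ else t₀)) (y∘σ≗x v))
    (eval-rename {x = x} {y} y∘σ≗x P (if lookup x v then t₁ else t₀))

-- `allVecs 0` holds only the empty vector, so the disjunction has a single term. Renaming bridges n
-- + 0 and n at the same size.
LNBP₀⇒BP : ∀ {n} (f : BoolFn n) k → LNBPRealizes 0 n f k → BPRealizes n f k
LNBP₀⇒BP {n} f k (P , s , correct) = rename σ P , s , λ x →
  trans (eval-rename (agree x) P s) (trans (sym (∨-identityʳ _)) (sym (correct x)))
  where
  σ : Fin (n + 0) → Fin n
  σ = [ id , (λ ()) ]′ ∘ splitAt n
  agree : ∀ x i → lookup x (σ i) ≡ lookup (x ++ []) i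
  agree x i rewrite lookup-splitAt n x [] i with splitAt n i
  ... | inj₁ _ = refl

BP⇒LNBP₀-neciporuk : ∀ {b} → IsNeciporuk BPRealizes b → IsNeciporuk (LNBPRealizes 0) b
BP⇒LNBP₀-neciporuk (mono , lower) =
  mono , λ n f p c partition k realized → lower n f p c partition k (LNBP₀⇒BP f k realized)

-- For δ = 0 the factor Q is t², and t² ≤ 2 · 2^t absorbs the linear part: 9 · 2 + 144 = 162,
-- doubled to 324 by 2^t ≤ 2n.
BP-bound : ∀ {b n p} → IsNeciporuk BPRealizes b → 1 ≤ n → (f : BoolFn n) (c : Fin n → Fin p) →
           IsPartition c → LeqCSqOverLog² 324 (necSum b f c) n
BP-bound {b} {n} nec 1≤n f c partition a q _ 2^a<n^q with bitLength n 1≤n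
... | t , 1≤t , n< , 2^t≤2n = begin
  L * a ^ 2
    ≤⟨ *-monoʳ-≤ L (^-monoˡ-≤ 2 (exponent-bound {n} {t} a q n< 2^a<n^q)) ⟩
  L * (t * q) ^ 2                              ≡⟨ regroup L t q ⟩
  L * (1 * (t * t)) * q ^ 2
    ≤⟨ *-monoˡ-≤ (q ^ 2) (necSum-bound (BP⇒LNBP₀-neciporuk nec) f c partition t 1≤t (<⇒≤ n<)) ⟩
  n * (9 * (1 * (t * t)) + 144 * 2 ^ t) * q ^ 2
    ≤⟨ *-monoˡ-≤ (q ^ 2) (*-monoʳ-≤ n (+-monoˡ-≤ (144 * 2 ^ t) (*-monoʳ-≤ 9 (*-monoʳ-≤ 1 (square≤2^ t))))) ⟩
  n * (9 * (1 * (2 * 2 ^ t)) + 144 * 2 ^ t) * q ^ 2   ≡⟨ cong (_* q ^ 2) (collect n (2 ^ t)) ⟩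
  162 * n * 2 ^ t * q ^ 2                      ≤⟨ *-monoˡ-≤ (q ^ 2) (*-monoʳ-≤ (162 * n) 2^t≤2n) ⟩
  162 * n * (2 * n) * q ^ 2                    ≡⟨ cong (_* q ^ 2) (square n) ⟩
  324 * n ^ 2 * q ^ 2                          ∎
  where
  L = necSum b f c
  regroup : ∀ L t q → L * (t * q * (t * q * 1)) ≡ L * (1 * (t * t)) * (q * (q * 1))
  regroup = solve-∀
  collect : ∀ n T → n * (9 * (1 * (2 * T)) + 144 * T) ≡ 162 * n * T
  collect = solve-∀
  square : ∀ n → 162 * n * (2 * n) ≡ 324 * (n * (n * 1))
  square = solve-∀

theorem7p4 : (∀ (F : (n : ℕ) → BoolFn n) (Δ : ℕ → ℕ) →
    ∃ λ (C : ℕ) → ∃ λ (N : ℕ) → ∀ n → N ≤ n →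
    ∀ (b : ℕ → ℕ) → IsNeciporuk (LNBPRealizes (Δ n)) b →
    ∀ p (c : Fin n → Fin p) → IsPartition c →
    LeqCΓ C (necSum b (F n) c) n (Δ n))
    × (∀ (F : (n : ℕ) → BoolFn n) →
    ∃ λ (C : ℕ) → ∃ λ (N : ℕ) → ∀ n → N ≤ n →
    ∀ (b : ℕ → ℕ) → IsNeciporuk BPRealizes b →
    ∀ p (c : Fin n → Fin p) → IsPartition c →
    LeqCSqOverLog² C (necSum b (F n) c) n)
theorem7p4 =
  -- The constants depend on neither `F` nor `Δ`; the threshold 1 supplies the n ≥ 1 that
  -- `bitLength` asks for.
  (λ F Δ → 576 , 1 , λ n 1≤n b nec p c → LNBP-bound nec 1≤n (F n) c) ,
  (λ F → 324 , 1 , λ n 1≤n b nec p c → BP-bound nec 1≤n (F n) c)
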